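{- Let $k\geq 3$ and $n_1=\cdots=n_k\geq 2$. The number of distinct isomorphism classes of graphs in the LC orbit of the complete $k$-partite graph $K_{n_1,\dots,n_k}$ is $$\left|\mathcal{O}(K_{n_1,\dots,n_k})/\cong\right| = \left\lfloor \tfrac{k}{2}\right\rfloor + k + 1.$$
   Context: Local complement $c_v(G)$: replace the subgraph induced on the neighbourhood of $v$ by its complement, leaving all other edges unchanged. $\mathcal{O}(G)$ is the set of labeled graphs on the vertex set of $G$ obtainable from $G$ by finite sequences of local complements; $\mathcal{O}(G)/\cong$ is this set modulo graph isomorphism. The complete $k$-partite graph has parts of sizes $n_1,\dots,n_k$ with two vertices adjacent iff in different parts. -}

module Defs where

open import Data.Nat using (ℕ; _*_)
open import Data.Bool using (Bool; not; _∧_; if_then_else_)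
open import Data.Fin using (Fin; remQuot)
open import Data.Fin.Properties using (_≟_)
open import Data.List using (List; []; _∷_)
open import Data.Product using (Σ; ∃; _×_; proj₁)
open import Function.Bundles using (_↔_; Inverse)
open import Relation.Nullary using (¬_)
open import Relation.Nullary.Decidable using (⌊_⌋)
open import Relation.Binary.PropositionalEquality using (_≡_)

-- A labelled graph on vertex set Fin N, given by its adjacency relation
-- (Bool-valued).  All graphs considered below (the complete multipartite
-- graph and its local complements) are simple: symmetric and loopless.
Graph : ℕ → Set
Graph N = Fin N → Fin N → Bool

_≐_ : ∀ {N} → Graph N → Graph N → Set
G ≐ H = ∀ x y → G x y ≡ H x y

lc : ∀ {N} → Fin N → Graph N → Graph N
lc v G x y = if not ⌊ x ≟ y ⌋ ∧ G v x ∧ G v y then not (G x y) else G x y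

lcSeq : ∀ {N} → List (Fin N) → Graph N → Graph N
lcSeq []       G = G
lcSeq (v ∷ vs) G = lcSeq vs (lc v G)

InOrbit : ∀ {N} → Graph N → Graph N → Set
InOrbit {N} G H = ∃ λ (vs : List (Fin N)) → lcSeq vs G ≐ H

_≅_ : ∀ {N} → Graph N → Graph N → Set
_≅_ {N} G H = Σ (Fin N ↔ Fin N) λ σ →
  ∀ x y → G x y ≡ H (Inverse.to σ x) (Inverse.to σ y)

OrbitIsoClassCount : ∀ {N} → Graph N → ℕ → Set
OrbitIsoClassCount {N} G m =
  Σ (Fin m → Graph N) λ R →
    (∀ i → InOrbit G (R i)) ×
    (∀ i j → R i ≅ R j → i ≡ j) ×
    (∀ H → InOrbit G H → ∃ λ i → H ≅ R i)

completeMultipartite : (k n : ℕ) → Graph (k * n)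
completeMultipartite k n x y =
  not ⌊ proj₁ (remQuot {k} n x) ≟ proj₁ (remQuot {k} n y) ⌋

{-# OPTIONS --safe #-}
-- The graph is encoded by its split tree: a central node with one leaf node per
-- part. A local complement changes only the types of these nodes, and the trees
-- met have a complete centre with an even number of star parts, or a star centre
-- at a part c whose own type is forced by the parity of the number of star parts.
-- Up to isomorphism only that number matters: it takes ⌊k/2⌋ + 1 even values for a
-- complete centre and k values for a star centre. It is an isomorphism invariant,
-- since it counts the vertices with a neighbour of degree one; and only a star
-- centre gives nonadjacent vertices with a common neighbour and incomparable
-- neighbourhoods.
module Submission where

open import Defs
open import Data.Nat using (ℕ; _+_; _≤_; _/_)
open import Data.Nat using (zero; suc; _*_; _<_; _<ᵇ_; z≤n; s≤s)
open import Data.Nat.Properties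
  using (≤-refl; ≤-trans; ≤-reflexive; ≤-antisym; <⇒≤; <⇒≢; <-trans; ≤-<-trans; <ᵇ⇒<; ≮⇒≥; n≤1+n;
         +-comm; *-monoˡ-≤; *-cancelʳ-≡)
open import Data.Nat.DivMod using (m/n*n≤m; m*n/n≡m; /-monoˡ-≤)
open import Data.Bool using (Bool; T; true; false; not; _∧_; _∨_; _xor_; if_then_else_)
open import Data.Bool.Properties
  using (∧-zeroʳ; ∧-identityʳ; ∧-comm; ∨-comm; ∨-zeroʳ; not-involutive; xor-identityʳ;
         not-distribˡ-xor; not-distribʳ-xor)
open import Data.Empty using (⊥; ⊥-elim)
open import Data.Fin
  using (Fin; zero; suc; toℕ; fromℕ; fromℕ<; punchIn; inject≤; combine; remQuot; splitAt; join)
open import Data.Fin.Permutation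
  using (Permutation; _⟨$⟩ʳ_; _⟨$⟩ˡ_; inverseˡ; id; _∘ₚ_; lift₀; insert; insert-punchIn; transpose)
open import Data.Fin.Properties
  using (_≟_; suc-injective; toℕ-injective; toℕ<n; toℕ-fromℕ; toℕ-fromℕ<; combine-remQuot;
         remQuot-combine; *↔×;
         toℕ-inject≤; inject≤-injective; injective⇒≤; splitAt-join; join-splitAt)
open import Data.List using (List; []; _∷_; _∷ʳ_)
open import Data.Maybe as Maybe using (Maybe; just; nothing; maybe; is-just)
open import Data.Product using (Σ; ∃; _×_; _,_; proj₁; proj₂; uncurry)
open import Data.Product.Function.Dependent.Propositional using (Σ-↔)
open import Data.Sum using (_⊎_; inj₁; inj₂)
open import Function using (_∘_; case_of_)
open import Function.Bundles using (_↔_; Inverse)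
open import Function.Properties.Inverse using (↔-sym; ↔-trans)
open import Relation.Nullary using (¬_; Dec; yes; no)
open import Relation.Nullary.Decidable using (⌊_⌋; dec-true)
open import Relation.Binary.PropositionalEquality
  using (_≡_; _≢_; refl; sym; trans; cong; cong₂; subst)

private variable
  k n : ℕ

-- Boolean equality on `Fin`.

⌊≟⌋-refl : (i : Fin n) → ⌊ i ≟ i ⌋ ≡ true
⌊≟⌋-refl i with i ≟ i
... | yes _ = refl
... | no i≢i = ⊥-elim (i≢i refl)

⌊≟⌋-false : {i j : Fin n} → i ≢ j → ⌊ i ≟ j ⌋ ≡ false
⌊≟⌋-false {i = i} {j} i≢j with i ≟ j
... | yes i≡j = ⊥-elim (i≢j i≡j)
... | no _ = refl

⌊≟⌋⇒≡ : {i j : Fin n} → ⌊ i ≟ j ⌋ ≡ true → i ≡ j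
⌊≟⌋⇒≡ {i = i} {j} eq with i ≟ j
⌊≟⌋⇒≡ eq | yes i≡j = i≡j
⌊≟⌋⇒≡ () | no _

-- Local complementation of graphs given by a quotient and part shapes.

Vertex : ℕ → ℕ → Set
Vertex k n = Fin k × Fin n

PartGraph : ℕ → ℕ → Set
PartGraph k n = Vertex k n → Vertex k n → Bool

same : Vertex k n → Vertex k n → Bool
same (i , p) (j , q) = ⌊ i ≟ j ⌋ ∧ ⌊ p ≟ q ⌋

localComplement : Vertex k n → PartGraph k n → PartGraph k n
localComplement v A x y = if not (same x y) ∧ A v x ∧ A v y then not (A x y) else A x y

-- The shape of a part, as a leaf node of the split tree: an independent set
-- or a clique all of whose vertices see the rest of the graph, or a star whose
-- centre alone sees the rest.
data Shape (n : ℕ) : Set where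
  indep clique : Shape n
  starAt : Fin n → Shape n

inner : Shape n → Fin n → Fin n → Bool
inner indep      p q = false
inner clique     p q = not ⌊ p ≟ q ⌋
inner (starAt r) p q = not ⌊ p ≟ q ⌋ ∧ (⌊ r ≟ p ⌋ ∨ ⌊ r ≟ q ⌋)

exposed : Shape n → Fin n → Bool
exposed indep      p = true
exposed clique     p = true
exposed (starAt r) p = ⌊ r ≟ p ⌋

splitGraph : (Fin k → Fin k → Bool) → (Fin k → Shape n) → PartGraph k n
splitGraph quot shape (i , p) (j , q) =
  if ⌊ i ≟ j ⌋ then inner (shape i) p q
  else exposed (shape i) p ∧ exposed (shape j) q ∧ quot i j

-- The new type of the part that contains the complemented vertex `p`, for `p` exposed. In the star
-- case exposure makes `p` the centre, so complementing among the leaves joins them all. In the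
-- clique case the other vertices lose their mutual edges and also their edges to the outside
-- neighbours of `p`.
pivot : Fin n → Shape n → Shape n
pivot p indep      = indep
pivot p clique     = starAt p
pivot p (starAt _) = clique

-- The new type of a part all of whose exposed vertices neighbour the complemented vertex. A star
-- has a single exposed vertex, hence no pair to complement.
toggle : Shape n → Shape n
toggle indep      = clique
toggle clique     = indep
toggle (starAt r) = starAt r

-- Local complementation at `i` of the quotient. Pairs containing `i` are excluded by hand because
-- the diagonal value `quot i i` may be true.
lcQuot : Fin k → (Fin k → Fin k → Bool) → Fin k → Fin k → Bool
lcQuot i quot a b =
  quot a b xor ((not ⌊ i ≟ a ⌋ ∧ not ⌊ i ≟ b ⌋) ∧ quot i a ∧ quot i b)

lcShape : Vertex k n → (Fin k → Fin k → Bool) → (Fin k → Shape n) → Fin k → Shape n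
lcShape (i , p) quot shape a =
  if ⌊ i ≟ a ⌋ then pivot p (shape i) else (if quot i a then toggle (shape a) else shape a)

exposed-toggle : (b : Bool) (s : Shape n) (p : Fin n) →
  exposed (if b then toggle s else s) p ≡ exposed s p
exposed-toggle false s          p = refl
exposed-toggle true  indep      p = refl
exposed-toggle true  clique     p = refl
exposed-toggle true  (starAt _) p = refl

lc-inner-pivot : (s : Shape n) (p u w : Fin n) → exposed s p ≡ true →
  (if not ⌊ u ≟ w ⌋ ∧ inner s p u ∧ inner s p w then not (inner s u w) else inner s u w)
  ≡ inner (pivot p s) u w
lc-inner-pivot indep p u w _ with ⌊ u ≟ w ⌋
... | false = refl
... | true = refl
lc-inner-pivot clique p u w _ with ⌊ u ≟ w ⌋ | ⌊ p ≟ u ⌋ | ⌊ p ≟ w ⌋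
... | true  | _     | _     = refl
... | false | true  | _     = refl
... | false | false | true  = refl
... | false | false | false = refl
lc-inner-pivot (starAt r) p u w e with refl ← ⌊≟⌋⇒≡ {i = r} {p} e
  rewrite ⌊≟⌋-refl r with ⌊ u ≟ w ⌋ | ⌊ r ≟ u ⌋ | ⌊ r ≟ w ⌋
... | true  | _     | _     = refl
... | false | true  | _     = refl
... | false | false | true  = refl
... | false | false | false = refl

lc-inner-toggle : (s : Shape n) (u w : Fin n) →
  (if not ⌊ u ≟ w ⌋ ∧ exposed s u ∧ exposed s w then not (inner s u w) else inner s u w)
  ≡ inner (toggle s) u w
lc-inner-toggle indep u w with ⌊ u ≟ w ⌋
... | true  = refl
... | false = refl
lc-inner-toggle clique u w with ⌊ u ≟ w ⌋
... | true  = refl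
... | false = refl
lc-inner-toggle (starAt r) u w with u ≟ w | r ≟ u | r ≟ w
... | yes _   | _     | _       = refl
... | no u≢w | yes refl | yes refl = ⊥-elim (u≢w refl)
... | no _   | yes _ | no _    = refl
... | no _   | no _  | _       = refl

-- Here `o` stands for the adjacency of `p` to a fixed vertex outside the part; since `p` is
-- exposed, every exposed vertex of the part has this same adjacency. A vertex `u` of the part has
-- its pair with the outside vertex flipped exactly when `u` neighbours `p` and `o` holds.
lc-exposed-pivot : (s : Shape n) (p u : Fin n) (o : Bool) → exposed s p ≡ true →
  (if inner s p u ∧ o then not (exposed s u ∧ o) else exposed s u ∧ o)
  ≡ exposed (pivot p s) u ∧ o
lc-exposed-pivot indep  p u o _ = refl
lc-exposed-pivot clique p u o _ with ⌊ p ≟ u ⌋ | o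
... | true  | _     = refl
... | false | true  = refl
... | false | false = refl
lc-exposed-pivot (starAt r) p u o e with refl ← ⌊≟⌋⇒≡ {i = r} {p} e
  rewrite ⌊≟⌋-refl r with ⌊ r ≟ u ⌋ | o
... | true  | _     = refl
... | false | true  = refl
... | false | false = refl

-- The case of two vertices in two distinct parts, neither of them the part of the complemented
-- vertex: `x` and `y` are their exposures, `c` and `d` the quotient edges to that part, `e` the
-- quotient edge between their own parts.
lc-quot : (x y c d e : Bool) →
  (if (x ∧ c) ∧ (y ∧ d) then not (x ∧ y ∧ e) else x ∧ y ∧ e) ≡ x ∧ y ∧ (e xor (c ∧ d))
lc-quot false _     _     _     _     = refl
lc-quot true  false false _     _     = refl
lc-quot true  false true  _     _     = refl
lc-quot true  true  true  true  true  = refl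
lc-quot true  true  true  true  false = refl
lc-quot true  true  true  false true  = refl
lc-quot true  true  true  false false = refl
lc-quot true  true  false _     true  = refl
lc-quot true  true  false _     false = refl

∧-swap : (x y z : Bool) → x ∧ (y ∧ z) ≡ y ∧ (x ∧ z)
∧-swap false y     z = sym (∧-zeroʳ y)
∧-swap true  y     z = refl

-- Outside its own part, an exposed vertex sees exactly the exposed vertices of the parts adjacent
-- to it in the quotient, so the complement acts separately on each node of the split tree. The
-- cases are: both vertices in the part of `p`, both in one other part, exactly one in the part of
-- `p`, and two further parts.
lc-splitGraph : (quot : Fin k → Fin k → Bool) (shape : Fin k → Shape n) →
  (∀ a b → quot a b ≡ quot b a) → ∀ i p → exposed (shape i) p ≡ true →
  ∀ x y → localComplement (i , p) (splitGraph quot shape) x y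
        ≡ splitGraph (lcQuot i quot) (lcShape (i , p) quot shape) x y
lc-splitGraph quot shape quot-sym i p e (a , u) (b , w) with a ≟ b
lc-splitGraph quot shape quot-sym i p e (a , u) (a , w) | yes refl with i ≟ a
... | yes refl = lc-inner-pivot (shape i) p u w e
... | no _ rewrite e with quot i a
...   | true
  rewrite ∧-identityʳ (exposed (shape a) u) | ∧-identityʳ (exposed (shape a) w)
  = lc-inner-toggle (shape a) u w
...   | false
  rewrite ∧-zeroʳ (exposed (shape a) u) | ∧-zeroʳ (not ⌊ u ≟ w ⌋) = refl
lc-splitGraph quot shape quot-sym i p e (a , u) (b , w) | no a≢b with i ≟ a | i ≟ b
... | yes refl | yes refl = ⊥-elim (a≢b refl)
... | yes refl | no _
  rewrite e | exposed-toggle (quot i b) (shape b) w | xor-identityʳ (quot i b)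
  = lc-exposed-pivot (shape i) p u _ e
-- The mirror image of the preceding case: `quot-sym` and a reordering of the conjunctions bring it
-- to the form of `lc-exposed-pivot`.
... | no _ | yes refl
  rewrite e | exposed-toggle (quot i a) (shape a) u | quot-sym a i | xor-identityʳ (quot i a)
        | ∧-swap (exposed (shape a) u) (exposed (shape i) w) (quot i a)
        | ∧-swap (exposed (shape a) u) (exposed (pivot p (shape i)) w) (quot i a)
        | ∧-comm (exposed (shape a) u ∧ quot i a) (inner (shape i) p w)
  = lc-exposed-pivot (shape i) p w _ e
... | no _ | no _
  rewrite e | exposed-toggle (quot i a) (shape a) u | exposed-toggle (quot i b) (shape b) w
  = lc-quot (exposed (shape a) u) (exposed (shape b) w) (quot i a) (quot i b) (quot a b)

-- States and their graphs.

splitGraph-cong : {quot quot′ : Fin k → Fin k → Bool} {shape shape′ : Fin k → Shape n} →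
  (∀ a b → a ≢ b → quot a b ≡ quot′ a b) → (∀ a → shape a ≡ shape′ a) →
  ∀ x y → splitGraph quot shape x y ≡ splitGraph quot′ shape′ x y
splitGraph-cong quot≗ shape≗ (a , u) (b , w) with a ≟ b
... | yes refl rewrite shape≗ a = refl
... | no a≢b rewrite shape≗ a | shape≗ b | quot≗ a b a≢b = refl

-- The split trees met along the orbit: the central node is complete, or a star
-- centred at the part c, and ℓ marks the parts that are stars, with their centres
-- (ℓ c is ignored in the second case, where part c is a clique iff odd is true).
data State (k n : ℕ) : Set where
  complete : (ℓ : Fin k → Maybe (Fin n)) → State k n
  star     : (c : Fin k) (odd : Bool) (ℓ : Fin k → Maybe (Fin n)) → State k n

fill : Shape n → Maybe (Fin n) → Shape n
fill s = maybe starAt s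

hub : Bool → Shape n
hub odd = if odd then clique else indep

exposed-hub : (odd : Bool) (p : Fin n) → exposed (hub odd) p ≡ true
exposed-hub true  p = refl
exposed-hub false p = refl

toggle-hub : (odd : Bool) → toggle (hub {n} odd) ≡ hub (not odd)
toggle-hub true  = refl
toggle-hub false = refl

quotient : State k n → Fin k → Fin k → Bool
quotient (complete _) a b = true
quotient (star c _ _) a b = ⌊ c ≟ a ⌋ ∨ ⌊ c ≟ b ⌋

shapes : State k n → Fin k → Shape n
shapes (complete ℓ) a   = fill indep (ℓ a)
shapes (star c odd ℓ) a =
  if ⌊ c ≟ a ⌋ then hub odd else fill clique (ℓ a)

graph : State k n → PartGraph k n
graph s = splitGraph (quotient s) (shapes s)

quotient-sym : (s : State k n) → ∀ a b → quotient s a b ≡ quotient s b a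
quotient-sym (complete _) a b = refl
quotient-sym (star c _ _) a b = ∨-comm ⌊ c ≟ a ⌋ ⌊ c ≟ b ⌋

-- Parity of the number of star parts.

parity : (Fin k → Bool) → Bool
parity {zero}  d = false
parity {suc k} d = d zero xor parity (d ∘ suc)

parity-cong : {d d′ : Fin k → Bool} → (∀ j → d j ≡ d′ j) → parity d ≡ parity d′
parity-cong {zero}  eq = refl
parity-cong {suc k} eq = cong₂ _xor_ (eq zero) (parity-cong (eq ∘ suc))

parity-flip : {d d′ : Fin k → Bool} (i : Fin k) →
  (∀ j → i ≢ j → d j ≡ d′ j) → d′ i ≡ not (d i) → parity d′ ≡ not (parity d)
parity-flip {d = d} zero same-off flipped
  rewrite flipped | parity-cong {d = d ∘ suc} (λ j → same-off (suc j) λ ())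
  = sym (not-distribˡ-xor (d zero) _)
parity-flip {d = d} {d′} (suc i) same-off flipped
  rewrite sym (same-off zero λ ())
        | parity-flip {d = d ∘ suc} {d′ ∘ suc} i
            (λ j i≢j → same-off (suc j) (i≢j ∘ suc-injective)) flipped
  = sym (not-distribʳ-xor (d zero) _)

starParity : (Fin k → Maybe (Fin n)) → Bool
starParity ℓ = parity (is-just ∘ ℓ)

_[_≔_] : {A : Set} → (Fin k → A) → Fin k → A → Fin k → A
(f [ i ≔ x ]) j = if ⌊ i ≟ j ⌋ then x else f j

update-at : {A : Set} (f : Fin k → A) (i : Fin k) (x : A) → (f [ i ≔ x ]) i ≡ x
update-at f i x rewrite ⌊≟⌋-refl i = refl

update-off : {A : Set} (f : Fin k → A) (i : Fin k) (x : A) → ∀ j → i ≢ j → (f [ i ≔ x ]) j ≡ f j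
update-off f i x j i≢j rewrite ⌊≟⌋-false i≢j = refl

starParity-update : (ℓ : Fin k → Maybe (Fin n)) (i : Fin k) (m : Maybe (Fin n)) →
  is-just m ≡ not (is-just (ℓ i)) → starParity (ℓ [ i ≔ m ]) ≡ not (starParity ℓ)
starParity-update ℓ i m flipped = parity-flip i
  (λ j i≢j → cong is-just (sym (update-off ℓ i m j i≢j)))
  (trans (cong is-just (update-at ℓ i m)) flipped)

-- The invariant of the orbit. Moving from a complete centre to a star centre records in `odd`
-- whether the new centre part was a star, and a nontrivial move at another part flips both `odd`
-- and the parity. With `ℓ c ≡ nothing`, `starParity` counts only parts that really are stars.
Admissible : State k n → Set
Admissible (complete ℓ)     = starParity ℓ ≡ false
Admissible (star c odd ℓ) = ℓ c ≡ nothing × starParity ℓ ≡ odd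

-- Local complements of states are states.

_≗₂_ : PartGraph k n → PartGraph k n → Set
A ≗₂ B = ∀ x y → A x y ≡ B x y

lc-graph : (s s′ : State k n) (i : Fin k) (p : Fin n) → exposed (shapes s i) p ≡ true →
  (∀ a b → a ≢ b → lcQuot i (quotient s) a b ≡ quotient s′ a b) →
  (∀ a → lcShape (i , p) (quotient s) (shapes s) a ≡ shapes s′ a) →
  localComplement (i , p) (graph s) ≗₂ graph s′
lc-graph s s′ i p e quot≗ shape≗ x y = trans
  (lc-splitGraph (quotient s) (shapes s) (quotient-sym s) i p e x y)
  (splitGraph-cong quot≗ shape≗ x y)

toggle-indep : (m : Maybe (Fin n)) → toggle (fill indep m) ≡ fill clique m
toggle-indep nothing  = refl
toggle-indep (just _) = refl

toggle-clique : (m : Maybe (Fin n)) → toggle (fill clique m) ≡ fill indep m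
toggle-clique nothing  = refl
toggle-clique (just _) = refl

-- In a complete quotient all parts other than `i` are pairwise adjacent neighbours of `i`, so only
-- the edges at `i` survive and every other part is toggled. The separate `ℓ′` allows the mark of
-- part `i` to be erased.
lc-complete : (ℓ ℓ′ : Fin k → Maybe (Fin n)) (odd : Bool) (i : Fin k) (p : Fin n) →
  exposed (fill indep (ℓ i)) p ≡ true →
  pivot p (fill indep (ℓ i)) ≡ hub odd →
  (∀ j → i ≢ j → ℓ j ≡ ℓ′ j) →
  localComplement (i , p) (graph (complete ℓ)) ≗₂ graph (star i odd ℓ′)
lc-complete ℓ ℓ′ odd i p e pivots ℓ≗ = lc-graph (complete ℓ) (star i odd ℓ′) i p e quot shape
  where
  quot : ∀ a b → a ≢ b → lcQuot i (quotient (complete ℓ)) a b ≡ quotient (star i odd ℓ′) a b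
  quot a b _ with ⌊ i ≟ a ⌋ | ⌊ i ≟ b ⌋
  ... | true  | _     = refl
  ... | false | true  = refl
  ... | false | false = refl
  shape : ∀ a → lcShape (i , p) (quotient (complete ℓ)) (shapes (complete ℓ)) a
              ≡ shapes (star i odd ℓ′) a
  shape a with i ≟ a
  ... | yes refl = pivots
  ... | no i≢a = trans (toggle-indep (ℓ a)) (cong (fill clique) (ℓ≗ a i≢a))

-- The reverse passage: the neighbours of `c` in the quotient are all other parts, pairwise
-- nonadjacent before and pairwise adjacent after. The separate `ℓ′` allows part `c` to acquire a
-- mark.
lc-star-centre : (odd : Bool) (ℓ ℓ′ : Fin k → Maybe (Fin n)) (c : Fin k) (p : Fin n) →
  pivot p (hub odd) ≡ fill indep (ℓ′ c) →
  (∀ j → c ≢ j → ℓ j ≡ ℓ′ j) →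
  localComplement (c , p) (graph (star c odd ℓ)) ≗₂ graph (complete ℓ′)
lc-star-centre odd ℓ ℓ′ c p pivots ℓ≗ = lc-graph (star c odd ℓ) (complete ℓ′) c p e quot shape
  where
  e : exposed (shapes (star c odd ℓ) c) p ≡ true
  e rewrite ⌊≟⌋-refl c = exposed-hub odd p
  quot : ∀ a b → a ≢ b → lcQuot c (quotient (star c odd ℓ)) a b ≡ true
  quot a b _ rewrite ⌊≟⌋-refl c with ⌊ c ≟ a ⌋ | ⌊ c ≟ b ⌋
  ... | true  | _     = refl
  ... | false | true  = refl
  ... | false | false = refl
  shape : ∀ a → lcShape (c , p) (quotient (star c odd ℓ)) (shapes (star c odd ℓ)) a
              ≡ fill indep (ℓ′ a)
  shape a rewrite ⌊≟⌋-refl c with c ≟ a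
  ... | yes refl = pivots
  ... | no c≢a = trans (toggle-clique (ℓ a)) (cong (fill indep) (ℓ≗ a c≢a))

-- The only quotient neighbour of `i` is `c`, so the quotient stays and, besides part `i`, only part
-- `c` is toggled; this is why `odd` flips while part `i` switches between clique and star.
lc-star-leaf : (odd : Bool) (ℓ : Fin k → Maybe (Fin n)) (c i : Fin k) (p : Fin n) → c ≢ i →
  (m : Maybe (Fin n)) → exposed (fill clique (ℓ i)) p ≡ true →
  pivot p (fill clique (ℓ i)) ≡ fill clique m →
  localComplement (i , p) (graph (star c odd ℓ)) ≗₂ graph (star c (not odd) (ℓ [ i ≔ m ]))
lc-star-leaf odd ℓ c i p c≢i m e pivots =
  lc-graph (star c odd ℓ) (star c (not odd) (ℓ [ i ≔ m ])) i p e′ quot shape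
  where
  e′ : exposed (shapes (star c odd ℓ) i) p ≡ true
  e′ rewrite ⌊≟⌋-false c≢i = e
  quot : ∀ a b → a ≢ b → lcQuot i (quotient (star c odd ℓ)) a b ≡ quotient (star c odd ℓ) a b
  quot a b a≢b rewrite ⌊≟⌋-false c≢i with c ≟ a | c ≟ b
  -- At the diagonal pair of `c` the two quotients would disagree. `splitGraph` never reads the
  -- diagonal, so this case is excluded by `a ≢ b`.
  ... | yes refl | yes refl = ⊥-elim (a≢b refl)
  ... | yes _ | no _
    rewrite ∧-zeroʳ (not ⌊ i ≟ a ⌋ ∧ not ⌊ i ≟ b ⌋) = refl
  ... | no _  | _
    rewrite ∧-zeroʳ (not ⌊ i ≟ a ⌋ ∧ not ⌊ i ≟ b ⌋) = xor-identityʳ _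
  shape : ∀ a → lcShape (i , p) (quotient (star c odd ℓ)) (shapes (star c odd ℓ)) a
              ≡ shapes (star c (not odd) (ℓ [ i ≔ m ])) a
  shape a with i ≟ a
  shape a | yes refl rewrite ⌊≟⌋-false c≢i = pivots
  shape a | no _ rewrite ⌊≟⌋-false c≢i with c ≟ a
  ... | yes _ = toggle-hub odd
  ... | no _  = refl

same⇒≡ : {x y : Vertex k n} → same x y ≡ true → x ≡ y
same⇒≡ {x = i , p} {j , q} eq with i ≟ j | p ≟ q
same⇒≡ eq | yes refl | yes refl = refl

same-refl : (x : Vertex k n) → same x x ≡ true
same-refl (i , p) rewrite ⌊≟⌋-refl i | ⌊≟⌋-refl p = refl

-- A neighbourhood with at most one vertex contains no pair to complement.
lc-pendant : (A : PartGraph k n) (v w : Vertex k n) →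
  (∀ x → A v x ≡ true → x ≡ w) → localComplement v A ≗₂ A
lc-pendant A v w unique x y with A v x in vx | A v y in vy
... | false | _ rewrite ∧-zeroʳ (not (same x y)) = refl
... | true | false rewrite ∧-zeroʳ (not (same x y)) = refl
... | true | true rewrite unique x vx | unique y vy | same-refl w = refl

-- A leaf of a star part is not exposed, so it has no neighbour beyond the star's centre. This makes
-- local complements at such vertices trivial, and later provides the vertices of degree one.
hidden-neighbour : (s : State k n) (i : Fin k) (p r : Fin n) → shapes s i ≡ starAt r → r ≢ p →
  ∀ x → graph s (i , p) x ≡ true → x ≡ (i , r)
hidden-neighbour s i p r eq r≢p (j , q) adj with i ≟ j
... | yes refl rewrite eq | ⌊≟⌋-false r≢p = cong (i ,_) (sym (⌊≟⌋⇒≡ (∧-trueʳ {not ⌊ p ≟ q ⌋} adj)))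
  where
  ∧-trueʳ : {a b : Bool} → a ∧ b ≡ true → b ≡ true
  ∧-trueʳ {true} eq = eq
... | no _ rewrite eq | ⌊≟⌋-false r≢p with () ← adj

StepFrom : State k n → Vertex k n → Set
StepFrom {k} {n} s v =
  Σ (State k n) λ s′ → Admissible s′ × localComplement v (graph s) ≗₂ graph s′

step-complete : (ℓ : Fin k → Maybe (Fin n)) → starParity ℓ ≡ false → (i : Fin k) (p : Fin n) →
  (m : Maybe (Fin n)) → ℓ i ≡ m → StepFrom (complete ℓ) (i , p)
step-complete ℓ even i p nothing ℓi =
  star i false ℓ , (ℓi , even)
  , lc-complete ℓ ℓ false i p (cong (λ m → exposed (fill indep m) p) ℓi)
      (cong (λ m → pivot p (fill indep m)) ℓi) λ _ _ → refl
step-complete ℓ even i p (just r) ℓi with r ≟ p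
... | no r≢p = complete ℓ , even , lc-pendant _ (i , p) (i , r)
          (hidden-neighbour (complete ℓ) i p r (cong (fill indep) ℓi) r≢p)
-- The centre of a star part becomes a clique hub: its mark disappears, leaving an odd number of
-- stars, as `odd = true` requires.
... | yes refl =
  star i true (ℓ [ i ≔ nothing ])
  , (update-at ℓ i nothing
    , trans (starParity-update ℓ i nothing (cong (not ∘ is-just) (sym ℓi))) (cong not even))
  , lc-complete ℓ _ true i p
      (trans (cong (λ m → exposed (fill indep m) p) ℓi) (⌊≟⌋-refl p))
      (cong (λ m → pivot p (fill indep m)) ℓi)
      λ j i≢j → sym (update-off ℓ i nothing j i≢j)

step-star-centre : (c : Fin k) (odd : Bool) (ℓ : Fin k → Maybe (Fin n)) → ℓ c ≡ nothing →
  starParity ℓ ≡ odd → (p : Fin n) → StepFrom (star c odd ℓ) (c , p)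
step-star-centre c false ℓ ℓc par p =
  complete ℓ , par , lc-star-centre false ℓ ℓ c p (cong (fill indep) (sym ℓc)) λ _ _ → refl
-- A clique hub turns into a star centred at `p`, and this additional star makes the number of stars
-- even.
step-star-centre c true ℓ ℓc par p =
  complete (ℓ [ c ≔ just p ])
  , trans (starParity-update ℓ c (just p) (cong (not ∘ is-just) (sym ℓc))) (cong not par)
  , lc-star-centre true ℓ _ c p (cong (fill indep) (sym (update-at ℓ c (just p))))
      λ j c≢j → sym (update-off ℓ c (just p) j c≢j)

step-star-leaf : (c : Fin k) (odd : Bool) (ℓ : Fin k → Maybe (Fin n)) → ℓ c ≡ nothing →
  starParity ℓ ≡ odd → (i : Fin k) (p : Fin n) → c ≢ i →
  (m : Maybe (Fin n)) → ℓ i ≡ m → StepFrom (star c odd ℓ) (i , p)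
step-star-leaf c odd ℓ ℓc par i p c≢i nothing ℓi =
  star c (not odd) (ℓ [ i ≔ just p ])
  , (trans (update-off ℓ i (just p) c (c≢i ∘ sym)) ℓc
    , trans (starParity-update ℓ i (just p) (cong (not ∘ is-just) (sym ℓi))) (cong not par))
  , lc-star-leaf odd ℓ c i p c≢i (just p) (cong (λ m → exposed (fill clique m) p) ℓi)
      (cong (λ m → pivot p (fill clique m)) ℓi)
step-star-leaf c odd ℓ ℓc par i p c≢i (just r) ℓi with r ≟ p
... | yes refl =
  star c (not odd) (ℓ [ i ≔ nothing ])
  , (trans (update-off ℓ i nothing c (c≢i ∘ sym)) ℓc
    , trans (starParity-update ℓ i nothing (cong (not ∘ is-just) (sym ℓi))) (cong not par))
  , lc-star-leaf odd ℓ c i p c≢i nothing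
      (trans (cong (λ m → exposed (fill clique m) p) ℓi) (⌊≟⌋-refl p))
      (cong (λ m → pivot p (fill clique m)) ℓi)
... | no r≢p =
  star c odd ℓ , (ℓc , par) , lc-pendant _ (i , p) (i , r)
    (hidden-neighbour (star c odd ℓ) i p r shape r≢p)
  where
  shape : shapes (star c odd ℓ) i ≡ starAt r
  shape rewrite ⌊≟⌋-false c≢i = cong (fill clique) ℓi

step : (s : State k n) → Admissible s → ∀ v → StepFrom s v
step (complete ℓ) even (i , p) = step-complete ℓ even i p (ℓ i) refl
step (star c odd ℓ) (ℓc , par) (i , p) = case c ≟ i of λ where
  (yes refl) → step-star-centre c odd ℓ ℓc par p
  (no c≢i)   → step-star-leaf c odd ℓ ℓc par i p c≢i (ℓ i) refl

-- Sequences of local complements on `Fin (k * n)`.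

toGraph : PartGraph k n → Graph (k * n)
toGraph {k} {n} A x y = A (remQuot {k} n x) (remQuot {k} n y)

toGraph-cong : {A B : PartGraph k n} → A ≗₂ B → toGraph {k} {n} A ≐ toGraph B
toGraph-cong A≗B x y = A≗B _ _

≐-trans : {N : ℕ} {G H K : Graph N} → G ≐ H → H ≐ K → G ≐ K
≐-trans G≐H H≐K x y = trans (G≐H x y) (H≐K x y)

⌊≟⌋-remQuot : (x y : Fin (k * n)) → ⌊ x ≟ y ⌋ ≡ same (remQuot {k} n x) (remQuot {k} n y)
⌊≟⌋-remQuot {k} {n} x y with x ≟ y
... | yes refl = sym (same-refl (remQuot {k} n x))
... | no x≢y with same (remQuot {k} n x) (remQuot {k} n y) in eq
...   | false = refl
...   | true = ⊥-elim (x≢y (trans (sym (combine-remQuot {k} n x))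
                      (trans (cong (uncurry combine) (same⇒≡ {k} {n} eq)) (combine-remQuot {k} n y))))

lc-toGraph : (A : PartGraph k n) (v : Fin (k * n)) →
  lc v (toGraph A) ≐ toGraph {k} {n} (localComplement (remQuot {k} n v) A)
lc-toGraph {k} {n} A v x y rewrite ⌊≟⌋-remQuot {k} {n} x y = refl

lc-cong : {N : ℕ} {G H : Graph N} (v : Fin N) → G ≐ H → lc v G ≐ lc v H
lc-cong v G≐H x y rewrite G≐H v x | G≐H v y | G≐H x y = refl

lcSeq-cong : {N : ℕ} (vs : List (Fin N)) {G H : Graph N} → G ≐ H → lcSeq vs G ≐ lcSeq vs H
lcSeq-cong []       G≐H = G≐H
lcSeq-cong (v ∷ vs) G≐H = lcSeq-cong vs (lc-cong v G≐H)

lcSeq-∷ʳ : {N : ℕ} (vs : List (Fin N)) (v : Fin N) (G : Graph N) →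
  lcSeq (vs ∷ʳ v) G ≡ lc v (lcSeq vs G)
lcSeq-∷ʳ []       v G = refl
lcSeq-∷ʳ (w ∷ vs) v G = lcSeq-∷ʳ vs v (lc w G)

lcSeq-admissible : (vs : List (Fin (k * n))) (s : State k n) → Admissible s →
  Σ (State k n) λ s′ → Admissible s′ × lcSeq vs (toGraph (graph s)) ≐ toGraph (graph s′)
lcSeq-admissible [] s adm = s , adm , λ _ _ → refl
lcSeq-admissible {k} {n} (v ∷ vs) s adm
  with s₁ , adm₁ , eq₁ ← step s adm (remQuot {k} n v)
  with s₂ , adm₂ , eq₂ ← lcSeq-admissible vs s₁ adm₁ =
  s₂ , adm₂ , ≐-trans (lcSeq-cong vs (≐-trans (lc-toGraph (graph s) v) (toGraph-cong eq₁))) eq₂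

-- `lcSeq` performs the head of its list first, so a further move is appended at the end.
InOrbit-lc : {G : Graph (k * n)} (A B : PartGraph k n) (v : Vertex k n) →
  localComplement v A ≗₂ B → InOrbit G (toGraph A) → InOrbit G (toGraph B)
InOrbit-lc {k} {n} {G} A B v eq (vs , reach) = vs ∷ʳ w , reach′
  where
  w : Fin (k * n)
  w = uncurry combine v
  A≗B : localComplement (remQuot {k} n w) A ≗₂ B
  A≗B rewrite remQuot-combine (proj₁ v) (proj₂ v) = eq
  reach′ : lcSeq (vs ∷ʳ w) G ≐ toGraph B
  reach′ rewrite lcSeq-∷ʳ vs w G =
    ≐-trans (lc-cong w reach) (≐-trans (lc-toGraph A w) (toGraph-cong A≗B))

unmarked : State k n
unmarked = complete λ _ → nothing

completeMultipartite-graph : completeMultipartite k n ≐ toGraph {k} {n} (graph unmarked)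
completeMultipartite-graph {k} {n} x y
  with proj₁ (remQuot {k} n x) ≟ proj₁ (remQuot {k} n y)
... | yes _ = refl
... | no _  = refl

unmarked-admissible : Admissible (unmarked {k} {n})
unmarked-admissible {k} = constant-false k
  where
  constant-false : ∀ k → parity {k} (λ _ → false) ≡ false
  constant-false zero    = refl
  constant-false (suc k) = constant-false k

-- Normal forms and their reachability.

oddℕ : ℕ → Bool
oddℕ zero    = false
oddℕ (suc a) = not (oddℕ a)

<ᵇ-suc : (a b : ℕ) → a ≢ b → (a <ᵇ suc b) ≡ (a <ᵇ b)
<ᵇ-suc zero    zero    0≢0 = ⊥-elim (0≢0 refl)
<ᵇ-suc zero    (suc b) _   = refl
<ᵇ-suc (suc a) zero    _   = refl
<ᵇ-suc (suc a) (suc b) a≢b = <ᵇ-suc a b (a≢b ∘ cong suc)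

<⇒<ᵇ≡true : {a b : ℕ} → a < b → (a <ᵇ b) ≡ true
<⇒<ᵇ≡true {zero}  (s≤s _) = refl
<⇒<ᵇ≡true {suc a} (s≤s a<b) = <⇒<ᵇ≡true a<b

<ᵇ≡true⇒< : {a b : ℕ} → (a <ᵇ b) ≡ true → a < b
<ᵇ≡true⇒< {a} {b} eq = <ᵇ⇒< a b (subst T (sym eq) _)

≥⇒<ᵇ≡false : {a b : ℕ} → b ≤ a → (a <ᵇ b) ≡ false
≥⇒<ᵇ≡false {a} z≤n = refl
≥⇒<ᵇ≡false (s≤s b≤a) = ≥⇒<ᵇ≡false b≤a

-- The normal form of a marking: up to permuting the parts and the vertices inside each part, only
-- the number of stars remains.
initial : ℕ → Fin k → Maybe (Fin (suc n))
initial a i = if toℕ i <ᵇ a then just zero else nothing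

initial-at : {a : ℕ} (i : Fin k) → toℕ i < a → initial {n = n} a i ≡ just zero
initial-at i i<a rewrite <⇒<ᵇ≡true i<a = refl

initial-off : {a : ℕ} (i : Fin k) → a ≤ toℕ i → initial {n = n} a i ≡ nothing
initial-off i a≤i rewrite ≥⇒<ᵇ≡false a≤i = refl

initial-suc : {a : ℕ} (i : Fin k) → toℕ i ≢ a → initial {n = n} (suc a) i ≡ initial a i
initial-suc {a = a} i i≢a rewrite <ᵇ-suc (toℕ i) a i≢a = refl

star-cong : (c : Fin k) (odd : Bool) {ℓ ℓ′ : Fin k → Maybe (Fin n)} → (∀ i → ℓ i ≡ ℓ′ i) →
  graph (star c odd ℓ) ≗₂ graph (star c odd ℓ′)
star-cong c odd eq = splitGraph-cong (λ _ _ _ → refl)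
  λ a → cong (λ m → if ⌊ c ≟ a ⌋ then hub odd else fill clique m) (eq a)

-- Induction on `a`: a first move at part `c` of the multipartite graph creates the star centre, and
-- each further move turns the next clique part into a star. The bound `a ≤ toℕ c` keeps these parts
-- distinct from `c`.
InOrbit-star : (c : Fin k) (a : ℕ) → a ≤ toℕ c →
  InOrbit (completeMultipartite k (suc n)) (toGraph {k} {suc n} (graph (star c (oddℕ a) (initial a))))
InOrbit-star {k} {n} c zero _ =
  InOrbit-lc (graph unmarked) (graph (star c false (initial 0))) (c , zero)
    (lc-complete (λ _ → nothing) _ false c zero refl refl λ _ _ → refl)
    ([] , completeMultipartite-graph {k} {suc n})
InOrbit-star {k} {n} c (suc a) a<c =
  InOrbit-lc (graph (star c (oddℕ a) (initial a)))
    (graph (star c (oddℕ (suc a)) (initial (suc a)))) (i , zero)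
    (λ x y → trans
      (lc-star-leaf (oddℕ a) (initial a) c i zero c≢i (just zero)
        (cong (λ m → exposed (fill clique m) zero) i∉)
        (cong (λ m → pivot zero (fill clique m)) i∉) x y)
      (star-cong c (not (oddℕ a)) extend x y))
    (InOrbit-star c a (<⇒≤ a<c))
  where
  a<k : a < k
  a<k = <-trans a<c (toℕ<n c)
  i : Fin k
  i = fromℕ< a<k
  i≡a : toℕ i ≡ a
  i≡a = toℕ-fromℕ< a<k
  c≢i : c ≢ i
  c≢i c≡i = <⇒≢ a<c (trans (sym i≡a) (cong toℕ (sym c≡i)))
  i∉ : initial {n = n} a i ≡ nothing
  i∉ = initial-off i (≤-reflexive (sym i≡a))
  extend : ∀ j → (initial a [ i ≔ just zero ]) j ≡ initial {n = n} (suc a) j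
  extend j with i ≟ j
  ... | yes refl = sym (initial-at i (s≤s (≤-reflexive i≡a)))
  ... | no i≢j = sym (initial-suc j λ j≡a → i≢j (toℕ-injective (trans i≡a (sym j≡a))))

-- For a positive number of stars, take one star fewer and the next part as centre. By parity this
-- centre is a clique, and a move at it makes it the last star.
InOrbit-complete : (a : ℕ) → a ≤ k → oddℕ a ≡ false →
  InOrbit (completeMultipartite k (suc n)) (toGraph {k} {suc n} (graph (complete (initial a))))
InOrbit-complete {k} {n} zero _ _ = [] , completeMultipartite-graph {k} {suc n}
InOrbit-complete {k} {n} (suc a) a<k even =
  InOrbit-lc (graph (star c (oddℕ a) (initial a))) (graph (complete (initial (suc a)))) (c , zero)
    (lc-star-centre (oddℕ a) (initial a) (initial (suc a)) c zero pivots
      λ j c≢j → sym (initial-suc j λ j≡a → c≢j (toℕ-injective (trans c≡a (sym j≡a)))))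
    (InOrbit-star c a (≤-reflexive (sym c≡a)))
  where
  c : Fin k
  c = fromℕ< a<k
  c≡a : toℕ c ≡ a
  c≡a = toℕ-fromℕ< a<k
  pivots : pivot zero (hub (oddℕ a)) ≡ fill indep (initial {n = n} (suc a) c)
  pivots rewrite initial-at {n = n} c (s≤s (≤-reflexive c≡a)) with oddℕ a
  ... | true = refl

-- Isomorphisms and reduction to normal form.

_≃_ : PartGraph k n → PartGraph k n → Set
_≃_ {k} {n} A B = Σ (Vertex k n ↔ Vertex k n) λ σ →
  ∀ x y → A x y ≡ B (Inverse.to σ x) (Inverse.to σ y)

≃-sym : (A B : PartGraph k n) → A ≃ B → B ≃ A
≃-sym A B (σ , preserves) = ↔-sym σ , λ x y → sym (trans (preserves _ _)
  (cong₂ B (Inverse.strictlyInverseˡ σ x) (Inverse.strictlyInverseˡ σ y)))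

≃⇒≅ : (A B : PartGraph k n) → A ≃ B → toGraph A ≅ toGraph B
≃⇒≅ {k} {n} A B (σ , preserves) = ↔-trans *↔× (↔-trans σ (↔-sym *↔×)) , λ x y →
  trans (preserves _ _) (sym (cong₂ B (remQuot-combine {k} {n} _ _) (remQuot-combine {k} {n} _ _)))

≅⇒≃ : (A B : PartGraph k n) → toGraph A ≅ toGraph B → A ≃ B
≅⇒≃ {k} {n} A B (σ , preserves) = ↔-trans (↔-sym *↔×) (↔-trans σ *↔×) , λ x y →
  trans (sym (cong₂ A (remQuot-combine {k} {n} _ _) (remQuot-combine {k} {n} _ _)))
        (preserves (uncurry combine x) (uncurry combine y))

≐-≅-trans : {N : ℕ} {G H K : Graph N} → G ≐ H → H ≅ K → G ≅ K
≐-≅-trans G≐H (σ , preserves) = σ , λ x y → trans (G≐H x y) (preserves x y)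

permute-injective : (π : Permutation n n) {i j : Fin n} → π ⟨$⟩ʳ i ≡ π ⟨$⟩ʳ j → i ≡ j
permute-injective π eq = trans (sym (inverseˡ π)) (trans (cong (π ⟨$⟩ˡ_) eq) (inverseˡ π))

⌊≟⌋-permute : (π : Permutation n n) (i j : Fin n) → ⌊ π ⟨$⟩ʳ i ≟ π ⟨$⟩ʳ j ⌋ ≡ ⌊ i ≟ j ⌋
⌊≟⌋-permute π i j with i ≟ j
... | yes refl = ⌊≟⌋-refl (π ⟨$⟩ʳ i)
... | no i≢j = ⌊≟⌋-false (i≢j ∘ permute-injective π)

mapShape : (Fin n → Fin n) → Shape n → Shape n
mapShape f indep      = indep
mapShape f clique     = clique
mapShape f (starAt r) = starAt (f r)

inner-permute : (π : Permutation n n) (s : Shape n) (p q : Fin n) →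
  inner (mapShape (π ⟨$⟩ʳ_) s) (π ⟨$⟩ʳ p) (π ⟨$⟩ʳ q) ≡ inner s p q
inner-permute π indep      p q = refl
inner-permute π clique     p q = cong not (⌊≟⌋-permute π p q)
inner-permute π (starAt r) p q
  rewrite ⌊≟⌋-permute π p q | ⌊≟⌋-permute π r p | ⌊≟⌋-permute π r q = refl

exposed-permute : (π : Permutation n n) (s : Shape n) (p : Fin n) →
  exposed (mapShape (π ⟨$⟩ʳ_) s) (π ⟨$⟩ʳ p) ≡ exposed s p
exposed-permute π indep      p = refl
exposed-permute π clique     p = refl
exposed-permute π (starAt r) p = ⌊≟⌋-permute π r p

-- The isomorphism moves the parts by `π` and the vertices inside part `i` by `τ i`.
graph-permute : (s s′ : State k n) (π : Permutation k k) (τ : Fin k → Permutation n n) →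
  (∀ i j → quotient s′ (π ⟨$⟩ʳ i) (π ⟨$⟩ʳ j) ≡ quotient s i j) →
  (∀ i → shapes s′ (π ⟨$⟩ʳ i) ≡ mapShape (τ i ⟨$⟩ʳ_) (shapes s i)) →
  graph s ≃ graph s′
graph-permute s s′ π τ quot shape = Σ-↔ π (λ {i} → τ i) , preserves
  where
  preserves : ∀ x y → graph s x y
    ≡ graph s′ (π ⟨$⟩ʳ proj₁ x , τ (proj₁ x) ⟨$⟩ʳ proj₂ x) (π ⟨$⟩ʳ proj₁ y , τ (proj₁ y) ⟨$⟩ʳ proj₂ y)
  preserves (i , p) (j , q)
    rewrite ⌊≟⌋-permute π i j | shape i | shape j | quot i j
          | exposed-permute (τ i) (shapes s i) p | exposed-permute (τ j) (shapes s j) q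
    with i ≟ j
  ... | yes refl = sym (inner-permute (τ i) (shapes s i) p q)
  ... | no _     = refl

toℕ-punchIn-fromℕ : (i : Fin k) → toℕ (punchIn (fromℕ k) i) ≡ toℕ i
toℕ-punchIn-fromℕ zero    = refl
toℕ-punchIn-fromℕ (suc i) = cong suc (toℕ-punchIn-fromℕ i)

sortBits : (d : Fin k → Bool) → Σ ℕ λ a → a ≤ k × oddℕ a ≡ parity d ×
  Σ (Permutation k k) λ π → ∀ i → d i ≡ (toℕ (π ⟨$⟩ʳ i) <ᵇ a)
sortBits {zero}  d = 0 , z≤n , refl , id , λ ()
sortBits {suc k} d with sortBits (d ∘ suc) | d zero in d₀
... | a , a≤k , odd , π , sorted | true =
  suc a , s≤s a≤k , cong not odd , lift₀ π , λ { zero → d₀ ; (suc i) → sorted i }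
... | a , a≤k , odd , π , sorted | false =
  -- The unmarked first index is sent to the last position, which is at least `a`; inserting at the
  -- end shifts no other value.
  a , ≤-trans a≤k (n≤1+n k) , odd , insert zero (fromℕ k) π , sorted′
  where
  sorted′ : ∀ i → d i ≡ (toℕ (insert zero (fromℕ k) π ⟨$⟩ʳ i) <ᵇ a)
  sorted′ zero = trans d₀ (sym (≥⇒<ᵇ≡false (≤-trans a≤k (≤-reflexive (sym (toℕ-fromℕ k))))))
  sorted′ (suc i) = trans (sorted i) (cong (_<ᵇ a)
    (sym (trans (cong toℕ (insert-punchIn zero (fromℕ k) π i)) (toℕ-punchIn-fromℕ (π ⟨$⟩ʳ i)))))

transpose-first : (i j : Fin n) → transpose i j ⟨$⟩ʳ i ≡ j
transpose-first i j rewrite dec-true (i ≟ i) refl = refl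

transpose-invariant : {A : Set} (f : Fin n → A) (i j : Fin n) → f i ≡ f j →
  ∀ l → f (transpose i j ⟨$⟩ʳ l) ≡ f l
transpose-invariant f i j fi≡fj l with l ≟ i
... | yes refl = sym fi≡fj
... | no _ with l ≟ j
...   | yes refl = fi≡fj
...   | no _ = refl

toZero : Maybe (Fin (suc n)) → Permutation (suc n) (suc n)
toZero nothing  = id
toZero (just r) = transpose r zero

initial-toZero : (m : Maybe (Fin (suc n))) (a : ℕ) (i : Fin k) →
  is-just m ≡ (toℕ i <ᵇ a) → initial a i ≡ Maybe.map (toZero m ⟨$⟩ʳ_) m
initial-toZero nothing  a i eq rewrite sym eq = refl
initial-toZero (just r) a i eq rewrite sym eq = cong just (sym (transpose-first r zero))

fill-map : (f : Fin n → Fin n) {s : Shape n} → mapShape f s ≡ s → (m : Maybe (Fin n)) →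
  fill s (Maybe.map f m) ≡ mapShape f (fill s m)
fill-map f fixed nothing  = sym fixed
fill-map f fixed (just _) = refl

fill-initial : (s : Shape (suc n)) → (∀ f → mapShape f s ≡ s) → (m : Maybe (Fin (suc n)))
  (a : ℕ) (i : Fin k) → is-just m ≡ (toℕ i <ᵇ a) →
  fill s (initial a i) ≡ mapShape (toZero m ⟨$⟩ʳ_) (fill s m)
fill-initial s fixed m a i eq = trans (cong (fill s) (initial-toZero m a i eq)) (fill-map _ (fixed _) m)

mapShape-hub : (f : Fin n → Fin n) (odd : Bool) → mapShape f (hub odd) ≡ hub odd
mapShape-hub f true  = refl
mapShape-hub f false = refl

complete-normalise : (ℓ : Fin k → Maybe (Fin (suc n))) → starParity ℓ ≡ false →
  Σ ℕ λ a → a ≤ k × oddℕ a ≡ false × graph (complete ℓ) ≃ graph (complete (initial a))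
complete-normalise ℓ even with a , a≤k , odd , π , sorted ← sortBits (is-just ∘ ℓ) =
  a , a≤k , trans odd even
  , graph-permute (complete ℓ) (complete (initial a)) π (toZero ∘ ℓ) (λ _ _ → refl)
      λ i → fill-initial indep (λ _ → refl) (ℓ i) a (π ⟨$⟩ʳ i) (sorted i)

-- The centre is unmarked, so sorting sends it to a position at least `a`; hence `a < k`, and
-- position `a` can serve as the new centre, determined by the number of stars alone.
star-normalise : (c : Fin k) (odd : Bool) (ℓ : Fin k → Maybe (Fin (suc n))) →
  ℓ c ≡ nothing → starParity ℓ ≡ odd →
  Σ (Fin k) λ b → graph (star c odd ℓ) ≃ graph (star b (oddℕ (toℕ b)) (initial (toℕ b)))
star-normalise {k} {n} c odd ℓ ℓc par with a , a≤k , odd-a , π , sorted ← sortBits (is-just ∘ ℓ) =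
  b , graph-permute (star c odd ℓ) (star b (oddℕ (toℕ b)) (initial (toℕ b))) ρ (toZero ∘ ℓ) quot shape
  where
  πc≮a : (toℕ (π ⟨$⟩ʳ c) <ᵇ a) ≡ false
  πc≮a = trans (sym (sorted c)) (cong is-just ℓc)
  a≤πc : a ≤ toℕ (π ⟨$⟩ʳ c)
  a≤πc = ≮⇒≥ λ πc<a → case trans (sym πc≮a) (<⇒<ᵇ≡true πc<a) of λ ()
  a<k : a < k
  a<k = ≤-<-trans a≤πc (toℕ<n (π ⟨$⟩ʳ c))
  b : Fin k
  b = fromℕ< a<k
  b≡a : toℕ b ≡ a
  b≡a = toℕ-fromℕ< a<k
  -- After sorting, the centre is swapped into position `a`. Both swapped positions are unmarked, so
  -- the marks remain sorted.
  ρ : Permutation k k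
  ρ = π ∘ₚ transpose (π ⟨$⟩ʳ c) b
  ρc≡b : ρ ⟨$⟩ʳ c ≡ b
  ρc≡b = transpose-first (π ⟨$⟩ʳ c) b
  ρ-sorted : ∀ i → is-just (ℓ i) ≡ (toℕ (ρ ⟨$⟩ʳ i) <ᵇ toℕ b)
  ρ-sorted i rewrite b≡a = trans (sorted i) (sym (transpose-invariant (λ j → toℕ j <ᵇ a) (π ⟨$⟩ʳ c) b
    (trans πc≮a (sym (≥⇒<ᵇ≡false (≤-reflexive (sym b≡a))))) (π ⟨$⟩ʳ i)))
  centre : ∀ i → ⌊ b ≟ ρ ⟨$⟩ʳ i ⌋ ≡ ⌊ c ≟ i ⌋
  centre i = trans (cong (λ j → ⌊ j ≟ ρ ⟨$⟩ʳ i ⌋) (sym ρc≡b)) (⌊≟⌋-permute ρ c i)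
  quot : ∀ i j → ⌊ b ≟ ρ ⟨$⟩ʳ i ⌋ ∨ ⌊ b ≟ ρ ⟨$⟩ʳ j ⌋ ≡ ⌊ c ≟ i ⌋ ∨ ⌊ c ≟ j ⌋
  quot i j = cong₂ _∨_ (centre i) (centre j)
  shape : ∀ i → shapes (star b (oddℕ (toℕ b)) (initial (toℕ b))) (ρ ⟨$⟩ʳ i)
              ≡ mapShape (toZero (ℓ i) ⟨$⟩ʳ_) (shapes (star c odd ℓ) i)
  shape i rewrite centre i with ⌊ c ≟ i ⌋
  ... | true = trans (cong hub (trans (cong oddℕ b≡a) (trans odd-a par))) (sym (mapShape-hub _ odd))
  ... | false = fill-initial clique (λ _ → refl) (ℓ i) (toℕ b) (ρ ⟨$⟩ʳ i) (ρ-sorted i)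

-- The number of star parts as an isomorphism invariant.

otherVertex : (p : Fin (2 + n)) → ∃ λ q → p ≢ q
otherVertex zero    = suc zero , λ ()
otherVertex (suc p) = zero , λ ()

twoOthers : 3 ≤ k → (i : Fin k) → ∃ λ j → ∃ λ j′ → i ≢ j × i ≢ j′ × j ≢ j′
twoOthers (s≤s (s≤s (s≤s _))) zero          = suc zero , suc (suc zero) , (λ ()) , (λ ()) , λ ()
twoOthers (s≤s (s≤s (s≤s _))) (suc zero)    = zero , suc (suc zero) , (λ ()) , (λ ()) , λ ()
twoOthers (s≤s (s≤s (s≤s _))) (suc (suc i)) = zero , suc zero , (λ ()) , (λ ()) , λ ()

gate : Shape (suc n) → Fin (suc n)
gate indep      = zero
gate clique     = zero
gate (starAt r) = r

exposed-gate : (s : Shape (suc n)) → exposed s (gate s) ≡ true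
exposed-gate indep      = refl
exposed-gate clique     = refl
exposed-gate (starAt r) = ⌊≟⌋-refl r

outer-edge : (s : State k (suc n)) {i j : Fin k} {p q : Fin (suc n)} → i ≢ j →
  exposed (shapes s i) p ≡ true → exposed (shapes s j) q ≡ true → quotient s i j ≡ true →
  graph s (i , p) (j , q) ≡ true
outer-edge s i≢j ep eq adj rewrite ⌊≟⌋-false i≢j | ep | eq = adj

outer-nonedge : (s : State k n) {i j : Fin k} {p q : Fin n} → i ≢ j →
  quotient s i j ≡ false → graph s (i , p) (j , q) ≡ false
outer-nonedge s {i} {j} {p} {q} i≢j nonadj
  rewrite ⌊≟⌋-false i≢j | nonadj | ∧-zeroʳ (exposed (shapes s j) q) = ∧-zeroʳ (exposed (shapes s i) p)

inner-edge : (s : State k n) (i : Fin k) {p q : Fin n} →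
  exposed (shapes s i) p ≡ true → shapes s i ≢ indep → p ≢ q → graph s (i , p) (i , q) ≡ true
inner-edge s i {p} {q} e ¬indep p≢q rewrite ⌊≟⌋-refl i with shapes s i
... | indep = ⊥-elim (¬indep refl)
... | clique rewrite ⌊≟⌋-false p≢q = refl
... | starAt r rewrite ⌊≟⌋-false p≢q | e = refl

exposed-false : (s : Shape n) {p : Fin n} → exposed s p ≡ false → ∃ λ r → s ≡ starAt r × r ≢ p
exposed-false (starAt r) e = r , refl , λ { refl → case trans (sym e) (⌊≟⌋-refl r) of λ () }

-- What is needed for every exposed vertex to have two neighbours: one in an adjacent part, and
-- another in its own part or, if that part is independent, in a second adjacent part. With at least
-- three parts both kinds of state satisfy this.
Spread : State k n → Set
Spread {k} s = ∀ i → ∃ λ j → i ≢ j × quotient s i j ≡ true ×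
  (shapes s i ≡ indep → ∃ λ j′ → i ≢ j′ × j ≢ j′ × quotient s i j′ ≡ true)

complete-spread : 3 ≤ k → (ℓ : Fin k → Maybe (Fin n)) → Spread (complete ℓ)
complete-spread 3≤k ℓ i with j , j′ , i≢j , i≢j′ , j≢j′ ← twoOthers 3≤k i =
  j , i≢j , refl , λ _ → j′ , i≢j′ , j≢j′ , refl

star-spread : 3 ≤ k → (c : Fin k) (odd : Bool) (ℓ : Fin k → Maybe (Fin n)) → Spread (star c odd ℓ)
star-spread 3≤k c odd ℓ i with c ≟ i
... | yes refl with j , j′ , c≢j , c≢j′ , j≢j′ ← twoOthers 3≤k c =
  j , c≢j , refl , λ _ → j′ , c≢j′ , j≢j′ , refl
star-spread 3≤k c odd ℓ i | no c≢i = c , c≢i ∘ sym , ⌊≟⌋-refl c , absurd (ℓ i)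
  where
  absurd : {B : Set} (m : Maybe (Fin _)) → fill clique m ≡ indep → B
  absurd nothing  ()
  absurd (just _) ()

indep? : (s : Shape n) → Dec (s ≡ indep)
indep? indep      = yes refl
indep? clique     = no λ ()
indep? (starAt _) = no λ ()

exposed-branches : (s : State k (2 + n)) → Spread s → ∀ i p → exposed (shapes s i) p ≡ true →
  ∃ λ y → ∃ λ z → y ≢ z × graph s (i , p) y ≡ true × graph s (i , p) z ≡ true
exposed-branches s spread i p e
  with j , i≢j , adj , second ← spread i | indep? (shapes s i)
... | yes ind with j′ , i≢j′ , j≢j′ , adj′ ← second ind =
  (j , gate (shapes s j)) , (j′ , gate (shapes s j′)) , j≢j′ ∘ cong proj₁
  , outer-edge s i≢j e (exposed-gate (shapes s j)) adj
  , outer-edge s i≢j′ e (exposed-gate (shapes s j′)) adj′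
... | no ¬ind with q , p≢q ← otherVertex p =
  (j , gate (shapes s j)) , (i , q) , (λ eq → i≢j (sym (cong proj₁ eq)))
  , outer-edge s i≢j e (exposed-gate (shapes s j)) adj
  , inner-edge s i e ¬ind p≢q

-- The neighbour of a vertex of degree one, a notion preserved by isomorphisms.
Leader : PartGraph k n → Vertex k n → Set
Leader A y = ∃ λ x → A x y ≡ true × (∀ z → A x z ≡ true → z ≡ y)

-- Exposed vertices have two neighbours, so a vertex of degree one is hidden; it is then a leaf of a
-- star part, whose centre is its only neighbour.
leader⇒starAt : (s : State k (2 + n)) → Spread s → ∀ i p → Leader (graph s) (i , p) →
  shapes s i ≡ starAt p
leader⇒starAt s spread i p ((j , q) , adj , only) = decide (exposed (shapes s j) q) refl
  where
  decide : ∀ b → exposed (shapes s j) q ≡ b → shapes s i ≡ starAt p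
  decide true e with y , z , y≢z , adj-y , adj-z ← exposed-branches s spread j q e =
    ⊥-elim (y≢z (trans (only y adj-y) (sym (only z adj-z))))
  decide false e with r , shape , r≢q ← exposed-false (shapes s j) e
    with refl ← hidden-neighbour s j q r shape r≢q (i , p) adj = shape

starAt⇒leader : (s : State k (2 + n)) → ∀ i p → shapes s i ≡ starAt p → Leader (graph s) (i , p)
starAt⇒leader s i p shape with q , p≢q ← otherVertex p =
  (i , q) , adj , hidden-neighbour s i q p shape p≢q
  where
  adj : graph s (i , q) (i , p) ≡ true
  adj rewrite ⌊≟⌋-refl i | shape | ⌊≟⌋-false (p≢q ∘ sym) | ⌊≟⌋-refl p = ∨-zeroʳ ⌊ p ≟ q ⌋

Leader-map : (A B : PartGraph k n) ((σ , _) : A ≃ B) → ∀ y → Leader A y → Leader B (Inverse.to σ y)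
Leader-map A B (σ , preserves) y (x , adj , only) =
  Inverse.to σ x , trans (sym (preserves x y)) adj , λ z adj-z →
    trans (sym (Inverse.strictlyInverseˡ σ z)) (cong (Inverse.to σ) (only (Inverse.from σ z)
      (trans (preserves x (Inverse.from σ z))
        (trans (cong (B (Inverse.to σ x)) (Inverse.strictlyInverseˡ σ z)) adj-z))))

-- Together with the two lemmas on `Leader`, this says that in a `Spread` state the leaders are the
-- vertices `zero` of the first `a` parts, so `a` can be recovered from the graph.
record Starred (s : State k (suc n)) (a : ℕ) : Set where
  field
    bound   : a ≤ k
    at      : ∀ i → toℕ i < a → shapes s i ≡ starAt zero
    only    : ∀ i p → shapes s i ≡ starAt p → toℕ i < a × p ≡ zero

fill-starAt : {s : Shape (suc n)} → (∀ p → s ≢ starAt p) → (a : ℕ) (i : Fin k) (p : Fin (suc n)) →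
  fill s (initial a i) ≡ starAt p → toℕ i < a × p ≡ zero
fill-starAt {s = s} ¬star a i p eq with toℕ i <ᵇ a in i<a
fill-starAt ¬star a i p refl | true = <ᵇ≡true⇒< i<a , refl
fill-starAt ¬star a i p eq | false = ⊥-elim (¬star p eq)

complete-starred : (a : ℕ) → a ≤ k → Starred {k} {n} (complete (initial a)) a
complete-starred a a≤k = record
  { bound = a≤k
  ; at    = λ i i<a → cong (fill indep) (initial-at i i<a)
  ; only  = fill-starAt (λ _ ()) a
  }

star-starred : (c : Fin k) (odd : Bool) → Starred {k} {n} (star c odd (initial (toℕ c))) (toℕ c)
star-starred {k} {n} c odd = record { bound = <⇒≤ (toℕ<n c) ; at = at ; only = only }
  where
  at : ∀ i → toℕ i < toℕ c → shapes (star c odd (initial (toℕ c))) i ≡ starAt zero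
  at i i<c rewrite ⌊≟⌋-false {i = c} {i} (λ c≡i → <⇒≢ i<c (cong toℕ (sym c≡i))) =
    cong (fill clique) (initial-at i i<c)
  hub-starAt : (odd : Bool) (p : Fin (suc n)) → hub odd ≢ starAt p
  hub-starAt true  p ()
  hub-starAt false p ()
  only : ∀ i p → shapes (star c odd (initial (toℕ c))) i ≡ starAt p → toℕ i < toℕ c × p ≡ zero
  only i p eq with c ≟ i
  ... | yes _ = ⊥-elim (hub-starAt odd p eq)
  ... | no _  = fill-starAt (λ _ ()) (toℕ c) i p eq

-- An isomorphism maps leaders injectively to leaders. All leaders have second coordinate `zero`, so
-- their parts alone give an injection from `Fin a` to `Fin a′`.
starred-≤ : (s s′ : State k (2 + n)) {a a′ : ℕ} → Spread s′ → Starred s a → Starred s′ a′ →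
  graph s ≃ graph s′ → a ≤ a′
starred-≤ {k} {n} s s′ {a} {a′} spread st st′ iso@(σ , _) = injective⇒≤ {f = f} f-injective
  where
  open Starred
  leader : Fin a → Vertex k (2 + n)
  leader x = inject≤ x (bound st) , zero
  image : Fin a → Vertex k (2 + n)
  image x = Inverse.to σ (leader x)
  image-starred : ∀ x → toℕ (proj₁ (image x)) < a′ × proj₂ (image x) ≡ zero
  image-starred x = only st′ _ _ (leader⇒starAt s′ spread _ _
    (Leader-map (graph s) (graph s′) iso (leader x) (starAt⇒leader s _ _
      (at st _ (subst (_< a) (sym (toℕ-inject≤ x (bound st))) (toℕ<n x))))))
  f : Fin a → Fin a′
  f x = fromℕ< (proj₁ (image-starred x))
  f-injective : ∀ {x y} → f x ≡ f y → x ≡ y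
  f-injective {x} {y} eq = inject≤-injective _ _ x y (cong proj₁ leader≡)
    where
    image≡ : image x ≡ image y
    image≡ = cong₂ _,_
      (toℕ-injective (trans (sym (toℕ-fromℕ< _)) (trans (cong toℕ eq) (toℕ-fromℕ< _))))
      (trans (proj₂ (image-starred x)) (sym (proj₂ (image-starred y))))
    leader≡ : leader x ≡ leader y
    leader≡ = trans (sym (Inverse.strictlyInverseʳ σ (leader x)))
      (trans (cong (Inverse.from σ) image≡) (Inverse.strictlyInverseʳ σ (leader y)))

-- Separating star centres from complete centres.

record Crossing (A : PartGraph k n) : Set where
  field
    u w x u′ w′ : Vertex k n
    uw  : A u w ≡ false
    ux  : A u x ≡ true
    wx  : A w x ≡ true
    uu′ : A u u′ ≡ true
    wu′ : A w u′ ≡ false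
    ww′ : A w w′ ≡ true
    uw′ : A u w′ ≡ false

Crossing-map : (A B : PartGraph k n) → A ≃ B → Crossing A → Crossing B
Crossing-map A B (σ , preserves) cr = record
  { uw  = along uw
  ; ux  = along ux
  ; wx  = along wx
  ; uu′ = along uu′
  ; wu′ = along wu′
  ; ww′ = along ww′
  ; uw′ = along uw′
  }
  where
  open Crossing cr
  along : ∀ {x y b} → A x y ≡ b → B (Inverse.to σ x) (Inverse.to σ y) ≡ b
  along {x} {y} eq = trans (sym (preserves x y)) eq

true-false-absurd : {a b : Bool} → a ≡ b → a ≡ true → b ≡ false → ⊥
true-false-absurd refl refl ()

-- If `u` or `w` is hidden, it has one neighbour only, yet the other vertex distinguishes two of its
-- neighbours. If both are exposed, they are adjacent when in different parts, and have equal
-- neighbourhoods when in the same part.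
complete-¬crossing : (ℓ : Fin k → Maybe (Fin (suc n))) → ¬ Crossing (graph (complete ℓ))
complete-¬crossing {k} {n} ℓ cr = refute (exposed (shapes s i) p) (exposed (shapes s j) q) refl refl
  where
  open Crossing cr
  s : State k (suc n)
  s = complete ℓ
  i j : Fin k
  i = proj₁ u
  j = proj₁ w
  p q : Fin (suc n)
  p = proj₂ u
  q = proj₂ w
  twins : ∀ i p q m → ℓ i ≡ m → exposed (fill indep m) p ≡ true → exposed (fill indep m) q ≡ true →
    ∀ z → graph s (i , p) z ≡ graph s (i , q) z
  twins i p q nothing ℓi _ _ (l , _) with i ≟ l
  ... | yes refl rewrite ℓi = refl
  ... | no _ rewrite ℓi = refl
  twins i p q (just r) ℓi ep eq z with refl ← ⌊≟⌋⇒≡ {i = r} {p} ep | refl ← ⌊≟⌋⇒≡ {i = r} {q} eq = refl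
  refute : ∀ a b → exposed (shapes s i) p ≡ a → exposed (shapes s j) q ≡ b → ⊥
  refute false _ ep _ with r , shape , r≢p ← exposed-false (shapes s i) ep =
    true-false-absurd (cong (graph s w) (trans (hidden-neighbour s i p r shape r≢p x ux)
      (sym (hidden-neighbour s i p r shape r≢p u′ uu′)))) wx wu′
  refute true false _ eq with r , shape , r≢q ← exposed-false (shapes s j) eq =
    true-false-absurd (cong (graph s u) (trans (hidden-neighbour s j q r shape r≢q x wx)
      (sym (hidden-neighbour s j q r shape r≢q w′ ww′)))) ux uw′
  refute true true ep eq = case i ≟ j of λ where
    (no i≢j)  → true-false-absurd refl (outer-edge s i≢j ep eq refl) uw
    (yes i≡j) → true-false-absurd
      (trans (twins i p q (ℓ i) refl ep (trans (cong (λ l → exposed (shapes s l) q) i≡j) eq) u′)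
        (cong (λ l → graph s (l , q) u′) i≡j)) uu′ wu′

-- Take exposed vertices of two parts other than `c`: they are nonadjacent and share an exposed
-- vertex of `c` as neighbour. Neither part is independent, so each vertex also has a neighbour in
-- its own part, which the other does not see.
star-crossing : 3 ≤ k → (c : Fin k) (odd : Bool) (ℓ : Fin k → Maybe (Fin (2 + n))) →
  Crossing (graph (star c odd ℓ))
star-crossing {k} {n} 3≤k c odd ℓ with i , j , c≢i , c≢j , i≢j ← twoOthers 3≤k c = record
  { u   = i , gate (shapes s i)
  ; w   = j , gate (shapes s j)
  ; x   = c , gate (shapes s c)
  ; u′  = i , proj₁ (otherVertex (gate (shapes s i)))
  ; w′  = j , proj₁ (otherVertex (gate (shapes s j)))
  ; uw  = outer-nonedge s i≢j (apart c≢i c≢j)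
  ; ux  = to-centre c≢i
  ; wx  = to-centre c≢j
  ; uu′ = inside c≢i
  ; wu′ = outer-nonedge s (i≢j ∘ sym) (apart c≢j c≢i)
  ; ww′ = inside c≢j
  ; uw′ = outer-nonedge s i≢j (apart c≢i c≢j)
  }
  where
  s : State k (2 + n)
  s = star c odd ℓ
  apart : ∀ {i j} → c ≢ i → c ≢ j → quotient s i j ≡ false
  apart c≢i c≢j rewrite ⌊≟⌋-false c≢i | ⌊≟⌋-false c≢j = refl
  to-centre : ∀ {i} → c ≢ i → graph s (i , gate (shapes s i)) (c , gate (shapes s c)) ≡ true
  to-centre {i} c≢i = outer-edge s (c≢i ∘ sym) (exposed-gate (shapes s i)) (exposed-gate (shapes s c))
    (trans (cong (⌊ c ≟ i ⌋ ∨_) (⌊≟⌋-refl c)) (∨-zeroʳ _))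
  fill-clique : (m : Maybe (Fin (2 + n))) → fill clique m ≢ indep
  fill-clique nothing  ()
  fill-clique (just _) ()
  leaf : ∀ {i} → c ≢ i → shapes s i ≢ indep
  leaf {i} c≢i rewrite ⌊≟⌋-false c≢i = fill-clique (ℓ i)
  inside : ∀ {i} → c ≢ i →
    graph s (i , gate (shapes s i)) (i , proj₁ (otherVertex (gate (shapes s i)))) ≡ true
  inside {i} c≢i = inner-edge s i (exposed-gate (shapes s i)) (leaf c≢i)
    (proj₂ (otherVertex (gate (shapes s i))))

-- Counting the classes.

oddℕ-double : (t : ℕ) → oddℕ (t * 2) ≡ false
oddℕ-double zero    = refl
oddℕ-double (suc t) = trans (not-involutive _) (oddℕ-double t)

halve : (a : ℕ) → oddℕ a ≡ false → ∃ λ t → a ≡ t * 2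
halve zero          _ = 0 , refl
halve (suc (suc a)) even with t , refl ← halve a (trans (sym (not-involutive _)) even) =
  suc t , refl

double-≤ : {t : ℕ} → t < suc (k / 2) → t * 2 ≤ k
double-≤ {k} (s≤s t≤) = ≤-trans (*-monoˡ-≤ 2 t≤) (m/n*n≤m k 2)

module Classes (k n : ℕ) (3≤k : 3 ≤ k) where

  K : Graph (k * (2 + n))
  K = completeMultipartite k (2 + n)

  -- The left summand gives half the number of stars around a complete centre. In the right one, `c`
  -- is at once the centre part and the number of stars, which are the parts before it.
  Index : Set
  Index = Fin (suc (k / 2)) ⊎ Fin k

  size : Index → ℕ
  size (inj₁ t) = toℕ t * 2
  size (inj₂ c) = toℕ c

  state : Index → State k (2 + n)
  state (inj₁ t) = complete (initial (toℕ t * 2))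
  state (inj₂ c) = star c (oddℕ (toℕ c)) (initial (toℕ c))

  representative : Index → Graph (k * (2 + n))
  representative x = toGraph (graph (state x))

  reachable : ∀ x → InOrbit K (representative x)
  reachable (inj₁ t) = InOrbit-complete (toℕ t * 2) (double-≤ (toℕ<n t)) (oddℕ-double (toℕ t))
  reachable (inj₂ c) = InOrbit-star c (toℕ c) ≤-refl

  spread : ∀ x → Spread (state x)
  spread (inj₁ t) = complete-spread 3≤k (initial (toℕ t * 2))
  spread (inj₂ c) = star-spread 3≤k c (oddℕ (toℕ c)) (initial (toℕ c))

  starred : ∀ x → Starred (state x) (size x)
  starred (inj₁ t) = complete-starred (toℕ t * 2) (double-≤ (toℕ<n t))
  starred (inj₂ c) = star-starred c (oddℕ (toℕ c))

  size-≡ : ∀ x y → graph (state x) ≃ graph (state y) → size x ≡ size y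
  size-≡ x y iso = ≤-antisym
    (starred-≤ (state x) (state y) (spread y) (starred x) (starred y) iso)
    (starred-≤ (state y) (state x) (spread x) (starred y) (starred x)
      (≃-sym (graph (state x)) (graph (state y)) iso))

  complete≄star : ∀ t c → ¬ graph (state (inj₁ t)) ≃ graph (state (inj₂ c))
  complete≄star t c iso = complete-¬crossing (initial (toℕ t * 2))
    (Crossing-map (graph (state (inj₂ c))) (graph (state (inj₁ t)))
      (≃-sym (graph (state (inj₁ t))) (graph (state (inj₂ c))) iso)
      (star-crossing 3≤k c (oddℕ (toℕ c)) (initial (toℕ c))))

  distinct : ∀ x y → graph (state x) ≃ graph (state y) → x ≡ y
  distinct (inj₁ t) (inj₁ t′) iso =
    cong inj₁ (toℕ-injective (*-cancelʳ-≡ (toℕ t) (toℕ t′) 2 (size-≡ (inj₁ t) (inj₁ t′) iso)))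
  distinct (inj₂ c) (inj₂ c′) iso = cong inj₂ (toℕ-injective (size-≡ (inj₂ c) (inj₂ c′) iso))
  distinct (inj₁ t) (inj₂ c) iso = ⊥-elim (complete≄star t c iso)
  distinct (inj₂ c) (inj₁ t) iso =
    ⊥-elim (complete≄star t c (≃-sym (graph (state (inj₂ c))) (graph (state (inj₁ t))) iso))

  classify-complete : (ℓ : Fin k → Maybe (Fin (2 + n))) (a : ℕ) → a ≤ k → oddℕ a ≡ false →
    graph (complete ℓ) ≃ graph (complete (initial a)) →
    ∃ λ x → graph (complete ℓ) ≃ graph (state x)
  classify-complete ℓ a a≤k even iso =
    inj₁ (fromℕ< t<) , subst (λ b → graph (complete ℓ) ≃ graph (complete (initial b))) a≡ iso
    where
    t : ℕ
    t = proj₁ (halve a even)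
    t< : t < suc (k / 2)
    t< = s≤s (subst (_≤ k / 2) (trans (cong (_/ 2) (proj₂ (halve a even))) (m*n/n≡m t 2))
                    (/-monoˡ-≤ 2 a≤k))
    a≡ : a ≡ toℕ (fromℕ< t<) * 2
    a≡ = trans (proj₂ (halve a even)) (cong (_* 2) (sym (toℕ-fromℕ< t<)))

  classify : (s : State k (2 + n)) → Admissible s → ∃ λ x → graph s ≃ graph (state x)
  classify (complete ℓ) even =
    let a , a≤k , odd-a , iso = complete-normalise ℓ even in classify-complete ℓ a a≤k odd-a iso
  classify (star c odd ℓ) (ℓc , par) =
    let b , iso = star-normalise c odd ℓ ℓc par in inj₂ b , iso

  exhaustive : ∀ H → InOrbit K H → ∃ λ x → H ≅ representative x
  exhaustive H (vs , reach)
    with s , adm , eq ← lcSeq-admissible vs (unmarked {k} {2 + n}) (unmarked-admissible {k} {2 + n})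
    with x , iso ← classify s adm =
    x , ≐-≅-trans {H = toGraph (graph s)} {K = representative x}
      (≐-trans (λ y z → sym (reach y z))
        (≐-trans (lcSeq-cong vs (completeMultipartite-graph {k} {2 + n})) eq))
      (≃⇒≅ (graph s) (graph (state x)) iso)

  split : Fin (suc (k / 2) + k) → Index
  split = splitAt (suc (k / 2))

  orbitIsoClassCount : OrbitIsoClassCount K (suc (k / 2) + k)
  orbitIsoClassCount = representative ∘ split , reachable ∘ split , split-distinct , split-exhaustive
    where
    split-distinct : ∀ i j → representative (split i) ≅ representative (split j) → i ≡ j
    split-distinct i j iso = trans (sym (join-splitAt (suc (k / 2)) k i))
      (trans (cong (join (suc (k / 2)) k) (distinct (split i) (split j)
          (≅⇒≃ (graph (state (split i))) (graph (state (split j))) iso)))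
        (join-splitAt (suc (k / 2)) k j))
    split-exhaustive : ∀ H → InOrbit K H → ∃ λ i → H ≅ representative (split i)
    split-exhaustive H orbit with x , iso ← exhaustive H orbit =
      join (suc (k / 2)) k x
      , subst (λ y → H ≅ representative y) (sym (splitAt-join (suc (k / 2)) k x)) iso

theorem15 : (k n : ℕ) → 3 ≤ k → 2 ≤ n →
    OrbitIsoClassCount (completeMultipartite k n) (k / 2 + k + 1)
theorem15 k (suc (suc n)) 3≤k (s≤s (s≤s z≤n)) =
  -- The count `suc (k / 2) + k` computes to `1 + (k / 2 + k)`, so one commutation gives the stated
  -- form.
  subst (OrbitIsoClassCount (completeMultipartite k (2 + n))) (+-comm 1 (k / 2 + k))
    (Classes.orbitIsoClassCount k n 3≤k)
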